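{- For every positive integer $n$, the number of symmetric gapsets in $\mathcal{G}_{2n}(3n+1)$ is $2^{n-1}$.
   Context: A gapset is a finite set $G\subset\mathbb{N}=\{1,2,\dots\}$ such that whenever $z\in G$ and $z=x+y$ with $x,y\in\mathbb{N}$, then $x\in G$ or $y\in G$; its genus is $g=\#G$. Writing $G=\{\ell_1<\dots<\ell_g\}$, the Frobenius number is $F(G)=\ell_g$; $G$ is symmetric if $F(G)=2g-1$. $G$ is pure $\kappa$-sparse if $\ell_{i+1}-\ell_i\le\kappa$ for all $i$ with equality for some $i$; $\mathcal{G}_\kappa(g)$ is the set of pure $\kappa$-sparse gapsets of genus $g$. -}

module Defs where

open import Data.List.Base using (List; length; last; drop; zipWith)
open import Data.List.Membership.Propositional using (_∈_)
open import Data.List.Relation.Unary.All using (All)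
open import Data.List.Relation.Unary.Linked using (Linked)
open import Data.List.Relation.Unary.Unique.Propositional using (Unique)
open import Data.Maybe.Base using (just)
open import Data.Nat.Base using (ℕ; _+_; _*_; _∸_; _<_; _≤_)
open import Data.Product.Base using (_×_; ∃-syntax)
open import Data.Sum.Base using (_⊎_)
open import Function.Bundles using (_⇔_)
open import Relation.Binary.PropositionalEquality using (_≡_)

-- A finite set of positive integers {ℓ₁ < ⋯ < ℓ_g} is represented by the
-- strictly increasing list ℓ₁ ∷ ⋯ ∷ ℓ_g ∷ []; propositional equality of such
-- lists is equality of sets.
record IsGapset (G : List ℕ) : Set where
  field
    increasing : Linked _<_ G
    positive   : All (0 <_) G
    gap        : ∀ {x y} → 0 < x → 0 < y → (x + y) ∈ G → x ∈ G ⊎ y ∈ G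

genus : List ℕ → ℕ
genus = length

-- The Frobenius number of G is f.  The empty set has no largest element, so
-- no f qualifies there.
Frobenius : List ℕ → ℕ → Set
Frobenius G f = last G ≡ just f

-- The truncated subtraction is exact: a nonempty G has positive genus.
Symmetric : List ℕ → Set
Symmetric G = Frobenius G (2 * genus G ∸ 1)

-- The list of ℓᵢ₊₁ − ℓᵢ for 1 ≤ i < g: zipWith stops at the shorter list,
-- and the subtractions are exact on increasing lists.
differences : List ℕ → List ℕ
differences G = zipWith _∸_ (drop 1 G) G

record PureSparse (κ : ℕ) (G : List ℕ) : Set where
  field
    bounded  : All (_≤ κ) (differences G)
    attained : κ ∈ differences G

record 𝒢 (κ g : ℕ) (G : List ℕ) : Set where
  field
    isGapset   : IsGapset G
    pureSparse : PureSparse κ G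
    hasGenus   : genus G ≡ g

-- Exactly k elements of A satisfy P: they can be listed without repetition
-- in a list of length k.
HasCardinality : {A : Set} → (A → Set) → ℕ → Set
HasCardinality {A} P k =
  ∃[ xs ] (Unique {A = A} xs × length xs ≡ k × (∀ x → x ∈ xs ⇔ P x))

{-# OPTIONS --safe #-}

-- The multiplicity of a symmetric gapset with maximal difference 2n is 2n: the
-- mirror image x ↦ F − x of a difference of length 2n is a run of 2n − 1 gaps
-- preceded by a non-gap, which forces 1, …, 2n − 1 to be gaps, and the
-- difference below F then gives F − 2n ∈ G.  With m = 2n and F = 3m + 1 this
-- reads 2m + 1 ∈ G; since m ∉ G, splitting 2m + 1 = m + (m + 1) gives m + 1 ∈ G.
-- What remains of G are gaps between m + 2 and 2m − 1.  This interval is mapped to itself by x ↦ F − x, and G contains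
-- exactly one element of each of its n − 1 pairs {x, F − x}.  Conversely, every
-- choice of one element from each pair gives a gapset.
module Submission where

open import Data.Nat.Base using (ℕ; _+_; _*_; _∸_; _^_; _≤_)
open import Data.Product.Base using (_×_)
open import Defs

open import Data.Empty using (⊥)
open import Data.List.Base
  using (List; []; _∷_; [_]; _++_; _∷ʳ_; map; length; last; applyUpTo; upTo)
open import Data.List.Properties
  using (∷-injectiveʳ; ∷ʳ-injectiveˡ; ++-cancelˡ; ++-cancelʳ; length-++;
         length-map; length-applyUpTo; length-upTo; length-removeAt′)
open import Data.List.Membership.Propositional using (_∈_; _∉_)
open import Data.List.Membership.Propositional.Properties
  using (∈-map⁺; ∈-map⁻; ∈-++⁺ˡ; ∈-++⁺ʳ; ∈-++⁻; ∈-applyUpTo⁺; ∈-applyUpTo⁻; ∈-upTo⁻)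
open import Data.List.Membership.DecPropositional using (_∈?_)
open import Data.List.Relation.Binary.Subset.Propositional using (_⊆_)
open import Data.List.Relation.Unary.All as All using (All; []; _∷_)
import Data.List.Relation.Unary.All.Properties as All
open import Data.List.Relation.Unary.AllPairs as AllPairs using (AllPairs; []; _∷_)
import Data.List.Relation.Unary.AllPairs.Properties as AllPairs
open import Data.List.Relation.Unary.Any using (here; there; index; _─_)
open import Data.List.Relation.Unary.Linked as Linked using (Linked; []; [-]; _∷_)
open import Data.List.Relation.Unary.Linked.Properties
  using (AllPairs⇒Linked; Linked⇒AllPairs)
open import Data.List.Relation.Unary.Unique.Propositional using (Unique)
import Data.List.Relation.Unary.Unique.Propositional.Properties as Unique
open import Data.Maybe.Base using (just)
open import Data.Nat.Base using (zero; suc; _<_; z≤n; s≤s; z<s; s<s; s≤s⁻¹)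
open import Data.Nat.Properties
open import Data.Nat.Tactic.RingSolver using (solve-∀)
open import Data.Product.Base using (_,_; proj₁; proj₂; ∃-syntax)
open import Data.Sum.Base using (_⊎_; inj₁; inj₂; [_,_]′)
open import Function.Base using (_∘_; id; case_of_)
open import Function.Bundles using (mk⇔)
open import Relation.Binary.PropositionalEquality
  using (_≡_; _≢_; refl; sym; trans; cong; cong₂; subst; module ≡-Reasoning)
open import Relation.Nullary.Decidable using (yes; no)
open import Relation.Nullary.Negation using (contradiction)

-- Lists

∈-─⁺ : ∀ {A : Set} {x y : A} {ys} (y∈ys : y ∈ ys) → x ∈ ys → x ≢ y → x ∈ (ys ─ y∈ys)
∈-─⁺ (here refl)  (here refl)  x≢y = contradiction refl x≢y
∈-─⁺ (here refl)  (there x∈ys) x≢y = x∈ys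
∈-─⁺ (there y∈ys) (here refl)  x≢y = here refl
∈-─⁺ (there y∈ys) (there x∈ys) x≢y = there (∈-─⁺ y∈ys x∈ys x≢y)

-- Pigeonhole by deletion: the head of `xs` is removed from `ys`, and the tail still fits into what
-- remains because it avoids the head.
Unique-⊆⇒length≤ : ∀ {A : Set} {xs ys : List A} → Unique xs → xs ⊆ ys → length xs ≤ length ys
Unique-⊆⇒length≤ []           xs⊆ys = z≤n
Unique-⊆⇒length≤ {xs = x ∷ xs} {ys} (x∉xs ∷ xs!) xs⊆ys = begin
  suc (length xs)            ≤⟨ s≤s (Unique-⊆⇒length≤ xs! xs⊆ys─x) ⟩
  suc (length (ys ─ x∈ys))   ≡⟨ length-removeAt′ ys (index x∈ys) ⟨
  length ys                  ∎
  where
  open ≤-Reasoning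
  x∈ys : x ∈ ys
  x∈ys = xs⊆ys (here refl)
  xs⊆ys─x : xs ⊆ (ys ─ x∈ys)
  xs⊆ys─x z∈xs = ∈-─⁺ x∈ys (xs⊆ys (there z∈xs)) λ { refl → All.lookup x∉xs z∈xs refl }

increasing⇒Unique : ∀ {xs} → AllPairs _<_ xs → Unique xs
increasing⇒Unique = AllPairs.map <⇒≢

-- The heads agree: if `x` occurred after `y` in `y ∷ ys`, all of `x ∷ xs` would exceed `y` and so
-- fit into the shorter list `ys`.
increasing-⊆⇒≡ : ∀ {xs ys} → AllPairs _<_ xs → AllPairs _<_ ys →
                 length xs ≡ length ys → xs ⊆ ys → xs ≡ ys
increasing-⊆⇒≡ []           []           len xs⊆ys = refl
increasing-⊆⇒≡ {x ∷ xs} {y ∷ ys} xs↗@(x<xs ∷ xs↗′) (y<ys ∷ ys↗) len xs⊆ys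
  with xs⊆ys (here refl)
... | here refl = cong (x ∷_) (increasing-⊆⇒≡ xs↗′ ys↗ (suc-injective len) tail⊆)
  where
  tail⊆ : xs ⊆ ys
  tail⊆ z∈xs with xs⊆ys (there z∈xs)
  ... | here refl  = contradiction (All.lookup x<xs z∈xs) (<-irrefl refl)
  ... | there z∈ys = z∈ys
... | there x∈ys = contradiction (Unique-⊆⇒length≤ (increasing⇒Unique xs↗) all⊆)
                                 (<⇒≱ (≤-reflexive (sym len)))
  where
  above : ∀ {z} → z ∈ x ∷ xs → y < z
  above (here refl)  = All.lookup y<ys x∈ys
  above (there z∈xs) = <-trans (All.lookup y<ys x∈ys) (All.lookup x<xs z∈xs)
  all⊆ : x ∷ xs ⊆ ys
  all⊆ z∈ with xs⊆ys z∈
  ... | here refl  = contradiction (above z∈) (<-irrefl refl)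
  ... | there z∈ys = z∈ys

last-++ : ∀ {A : Set} (xs : List A) {y ys} → last (xs ++ y ∷ ys) ≡ last (y ∷ ys)
last-++ []            = refl
last-++ (x ∷ [])      = refl
last-++ (x ∷ x′ ∷ xs) = last-++ (x′ ∷ xs)

last-∈ : ∀ {A : Set} {v : A} xs → last xs ≡ just v → v ∈ xs
last-∈ (x ∷ [])      refl = here refl
last-∈ (x ∷ x′ ∷ xs) eq   = there (last-∈ (x′ ∷ xs) eq)

last-maximum : ∀ {v x xs} → AllPairs _<_ xs → last xs ≡ just v → x ∈ xs → x ≤ v
last-maximum {xs = _ ∷ []}    xs↗         refl (here refl) = ≤-refl
last-maximum {xs = _ ∷ _ ∷ _} (x<xs ∷ _)  eq   (here refl) = <⇒≤ (All.lookup x<xs (last-∈ _ eq))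
last-maximum {xs = _ ∷ _ ∷ _} (_ ∷ xs↗)   eq   (there x∈)  = last-maximum xs↗ eq x∈

-- The lists overlap in `y`, so the relation across the seam comes from the first of them.
Linked-glue : ∀ {A : Set} {R : A → A → Set} xs {y ys} →
              Linked R (xs ∷ʳ y) → Linked R (y ∷ ys) → Linked R (xs ++ y ∷ ys)
Linked-glue []            _        Rys = Rys
Linked-glue (x ∷ [])      (r ∷ _)  Rys = r ∷ Rys
Linked-glue (x ∷ x′ ∷ xs) (r ∷ rs) Rys = r ∷ Linked-glue (x′ ∷ xs) rs Rys

-- Differences

-- Order and size of a difference are kept together so that a single `Linked` proof yields both
-- `increasing` and `bounded`.
Step : ℕ → ℕ → ℕ → Set
Step κ a b = a < b × b ∸ a ≤ κ

-- Two points of a window of width `κ` are at most `κ` apart, wherever in it they lie.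
within⇒Linked-Step : ∀ {κ xs} a → Linked _<_ xs → All (λ x → a ≤ x × x ≤ a + κ) xs →
                     Linked (Step κ) xs
within⇒Linked-Step a []       _ = []
within⇒Linked-Step a [-]      _ = [-]
within⇒Linked-Step {κ} {x ∷ y ∷ _} a (x<y ∷ rs) ((a≤x , _) ∷ p@(_ , y≤a+κ) ∷ ps) =
  (x<y , m≤n+o⇒m∸n≤o y x (≤-trans y≤a+κ (+-monoˡ-≤ κ a≤x))) ∷ within⇒Linked-Step a rs (p ∷ ps)

Linked-Step⇒bounded : ∀ {κ xs} → Linked (Step κ) xs → All (_≤ κ) (differences xs)
Linked-Step⇒bounded []            = []
Linked-Step⇒bounded [-]           = []
Linked-Step⇒bounded ((_ , s) ∷ l) = s ∷ Linked-Step⇒bounded l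

∈-differences-++⁺ʳ : ∀ {d} xs {ys} → d ∈ differences ys → d ∈ differences (xs ++ ys)
∈-differences-++⁺ʳ []       d∈ = d∈
∈-differences-++⁺ʳ (x ∷ xs) d∈ = skip (∈-differences-++⁺ʳ xs d∈)
  where
  skip : ∀ {d x zs} → d ∈ differences zs → d ∈ differences (x ∷ zs)
  skip {zs = _ ∷ _} d∈ = there d∈

∈-differences⁻ : ∀ {κ G} → AllPairs _<_ G → κ ∈ differences G →
                 ∃[ a ] (a ∈ G × a + κ ∈ G × (∀ {x} → a < x → x < a + κ → x ∉ G))
∈-differences⁻ {G = a ∷ b ∷ G} ((a<b ∷ _) ∷ b<G ∷ _) (here refl) =
  a , here refl , there (here a+d≡b) , λ a<x x<a+d → gap-free a<x (subst (_ <_) a+d≡b x<a+d)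
  where
  a+d≡b : a + (b ∸ a) ≡ b
  a+d≡b = m+[n∸m]≡n (<⇒≤ a<b)
  gap-free : ∀ {x} → a < x → x < b → x ∉ a ∷ b ∷ G
  gap-free a<a _   (here refl)         = <-irrefl refl a<a
  gap-free _   b<b (there (here refl)) = <-irrefl refl b<b
  gap-free _   x<b (there (there x∈G)) = <-asym x<b (All.lookup b<G x∈G)
∈-differences⁻ {κ} {h ∷ b ∷ G} (h<G ∷ G↗) (there κ∈)
  with a , a∈ , a+κ∈ , free ← ∈-differences⁻ G↗ κ∈ = a , there a∈ , there a+κ∈ , gap-free
  where
  gap-free : ∀ {x} → a < x → x < a + κ → x ∉ h ∷ b ∷ G
  gap-free a<h _     (here refl) = <-asym a<h (All.lookup h<G a∈)
  gap-free a<x x<a+κ (there x∈)  = free a<x x<a+κ x∈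

-- The member `d` guarantees two elements in `G`, so that the last one has a predecessor; leaving
-- its value free lets the recursion use the first difference of the tail.
last-predecessor : ∀ {κ d f G} → AllPairs _<_ G → All (_≤ κ) (differences G) →
                   d ∈ differences G → last G ≡ just f →
                   ∃[ p ] (p ∈ G × p < f × f ≤ p + κ)
last-predecessor {G = a ∷ b ∷ []} ((a<b ∷ _) ∷ _) (b∸a≤κ ∷ _) _ refl =
  a , here refl , a<b , ≤-trans (m≤n+m∸n b a) (+-monoʳ-≤ a b∸a≤κ)
last-predecessor {G = a ∷ b ∷ c ∷ G} (_ ∷ G↗) (_ ∷ ds) _ eq
  with p , p∈ , p<f , f≤p+κ ← last-predecessor G↗ ds (here refl) eq =
  p , there p∈ , p<f , f≤p+κ

-- Choices of one element from each pair {x, y} with x + y = 2c + 2k − 1 in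
-- the interval [c, c + 2k)

selections : ℕ → ℕ → List (List ℕ)
selections zero    c = [ [] ]
selections (suc k) c =
  map (c ∷_) (selections k (suc c)) ++ map (_∷ʳ (suc c + (k + k))) (selections k (suc c))

-- Membership in `selections`, made inductive on the outermost pair: `c` and `suc c + (k + k)` are
-- the ends of the interval, and attaching either at its own side keeps the list sorted.
data Selection : ℕ → ℕ → List ℕ → Set where
  none : ∀ {c} → Selection 0 c []
  low  : ∀ {k c X} → Selection k (suc c) X → Selection (suc k) c (c ∷ X)
  high : ∀ {k c X} → Selection k (suc c) X → Selection (suc k) c (X ∷ʳ (suc c + (k + k)))

∈-selections⁺ : ∀ {k c X} → Selection k c X → X ∈ selections k c
∈-selections⁺ none     = here refl
∈-selections⁺ (low s)  = ∈-++⁺ˡ (∈-map⁺ _ (∈-selections⁺ s))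
∈-selections⁺ (high s) = ∈-++⁺ʳ _ (∈-map⁺ _ (∈-selections⁺ s))

∈-selections⁻ : ∀ k c {X} → X ∈ selections k c → Selection k c X
∈-selections⁻ zero    c (here refl) = none
∈-selections⁻ (suc k) c X∈ with ∈-++⁻ (map (c ∷_) (selections k (suc c))) X∈
... | inj₁ X∈low  with _ , Y∈ , refl ← ∈-map⁻ _ X∈low  = low (∈-selections⁻ k (suc c) Y∈)
... | inj₂ X∈high with _ , Y∈ , refl ← ∈-map⁻ _ X∈high = high (∈-selections⁻ k (suc c) Y∈)

length-selections : ∀ k c → length (selections k c) ≡ 2 ^ k
length-selections zero    c = refl
length-selections (suc k) c = begin
  length (map (c ∷_) S ++ map (_∷ʳ e) S)             ≡⟨ length-++ (map (c ∷_) S) ⟩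
  length (map (c ∷_) S) + length (map (_∷ʳ e) S)     ≡⟨ cong₂ _+_ (length-map _ S) (length-map _ S) ⟩
  length S + length S                                ≡⟨ cong₂ _+_ ih (trans ih (sym (+-identityʳ _))) ⟩
  2 ^ suc k                                          ∎
  where
  open ≡-Reasoning
  S = selections k (suc c)
  e = suc c + (k + k)
  ih = length-selections k (suc c)

upper-end : ∀ k c → c + (suc k + suc k) ≡ suc (suc c + (k + k))
upper-end = solve-∀

Selection-bounds : ∀ {k c X} → Selection k c X → All (λ x → c ≤ x × x < c + (k + k)) X
Selection-bounds none = []
Selection-bounds {suc k} {c} (low s) rewrite upper-end k c =
  (≤-refl , s≤s (m≤n⇒m≤1+n (m≤m+n c _))) ∷
  All.map (λ (l , u) → <⇒≤ l , m<n⇒m<1+n u) (Selection-bounds s)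
Selection-bounds {suc k} {c} (high s) rewrite upper-end k c =
  All.∷ʳ⁺ (All.map (λ (l , u) → <⇒≤ l , m<n⇒m<1+n u) (Selection-bounds s))
          (m≤n⇒m≤1+n (m≤m+n c _) , ≤-refl)

Selection-increasing : ∀ {k c X} → Selection k c X → AllPairs _<_ X
Selection-increasing none     = []
Selection-increasing (low s)  = All.map proj₁ (Selection-bounds s) ∷ Selection-increasing s
Selection-increasing (high s) =
  AllPairs.++⁺ (Selection-increasing s) ([] ∷ [])
               (All.map (λ (_ , u) → u ∷ []) (Selection-bounds s))

Selection-length : ∀ {k c X} → Selection k c X → length X ≡ k
Selection-length none             = refl
Selection-length (low s)          = cong suc (Selection-length s)
Selection-length (high {k} {X = X} s) =
  trans (length-++ X) (trans (+-comm _ 1) (cong suc (Selection-length s)))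

-- Removing both ends of an interval keeps its centre, so the inner pairs have the same sum as the
-- outer one.
inner-sum : ∀ k c → c + (c + (suc k + suc k)) ≡ suc c + (suc c + (k + k))
inner-sum = solve-∀

partner : ∀ k c y → suc (c + y) ≡ c + (c + (suc k + suc k)) → y ≡ suc c + (k + k)
partner k c y eq = +-cancelˡ-≡ (suc c) _ _ (trans eq (inner-sum k c))

-- Induction from the outside: if `x` or `y` is the lower end `c`, the sum makes the other the upper
-- end; otherwise both belong to the inner interval, since the sum forces the upper bounds. With no
-- pairs left, `x + y` is at least `c + c`, which is too large.
Selection-meets-pairs : ∀ {k c X} → Selection k c X → ∀ {x y} → c ≤ x → c ≤ y →
                        suc (x + y) ≡ c + (c + (k + k)) → x ∈ X ⊎ y ∈ X
Selection-meets-pairs {c = c} none {x} {y} c≤x c≤y eq =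
  contradiction (≤-reflexive (trans eq (cong (c +_) (+-identityʳ c)))) (≤⇒≯ (+-mono-≤ c≤x c≤y))
Selection-meets-pairs {suc k} {c} s c≤x c≤y eq
  with m≤n⇒m<n∨m≡n c≤x | m≤n⇒m<n∨m≡n c≤y
Selection-meets-pairs (low s) _ _ eq | inj₂ refl | _ = inj₁ (here refl)
Selection-meets-pairs (low s) _ _ eq | inj₁ _ | inj₂ refl = inj₂ (here refl)
Selection-meets-pairs {suc k} {c} (low s) _ _ eq | inj₁ c<x | inj₁ c<y =
  [ inj₁ ∘ there , inj₂ ∘ there ]′ (Selection-meets-pairs s c<x c<y (trans eq (inner-sum k c)))
Selection-meets-pairs {suc k} {c} (high {X = X} s) _ _ eq | inj₂ refl | _ =
  inj₂ (∈-++⁺ʳ X (here (partner k c _ eq)))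
Selection-meets-pairs {suc k} {c} (high {X = X} s) {x} _ _ eq | inj₁ _ | inj₂ refl =
  inj₁ (∈-++⁺ʳ X (here (partner k c _ (trans (cong suc (+-comm c x)) eq))))
Selection-meets-pairs {suc k} {c} (high s) _ _ eq | inj₁ c<x | inj₁ c<y =
  [ inj₁ ∘ ∈-++⁺ˡ , inj₂ ∘ ∈-++⁺ˡ ]′ (Selection-meets-pairs s c<x c<y (trans eq (inner-sum k c)))

selections-Unique : ∀ k c → Unique (selections k c)
selections-Unique zero    c = [] ∷ []
selections-Unique (suc k) c =
  Unique.++⁺ (Unique.map⁺ ∷-injectiveʳ ih) (Unique.map⁺ (∷ʳ-injectiveˡ _ _) ih) disjoint
  where
  ih = selections-Unique k (suc c)
  -- A `low` selection contains `c`, whereas all entries of a `high` one exceed `c`.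
  disjoint : ∀ {X} → X ∈ map (c ∷_) (selections k (suc c)) ×
                     X ∈ map (_∷ʳ (suc c + (k + k))) (selections k (suc c)) → ⊥
  disjoint (X∈low , X∈high)
    with _ , _ , refl ← ∈-map⁻ _ X∈low
    with Y , Y∈ , eq ← ∈-map⁻ _ X∈high =
    <-irrefl refl (All.lookup above (subst (c ∈_) eq (here refl)))
    where
    above : All (c <_) (Y ∷ʳ (suc c + (k + k)))
    above = All.∷ʳ⁺ (All.map proj₁ (Selection-bounds (∈-selections⁻ k (suc c) Y∈)))
                    (m≤m+n (suc c) _)

-- One member of `G` is picked from each pair. This yields only an inclusion; that `G` holds no more
-- in the interval is left to a later count.
Selection-within : ∀ k c {G} →
  (∀ {x y} → c ≤ x → c ≤ y → suc (x + y) ≡ c + (c + (k + k)) → x ∈ G ⊎ y ∈ G) →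
  ∃[ X ] (Selection k c X × X ⊆ G)
Selection-within zero    c meets = [] , none , λ ()
Selection-within (suc k) c {G} meets
  with X , s , X⊆G ← Selection-within k (suc c) {G} (λ c<x c<y eq →
         meets (<⇒≤ c<x) (<⇒≤ c<y) (trans eq (sym (inner-sum k c))))
  with meets ≤-refl (m≤n⇒m≤1+n (m≤m+n c (k + k))) (sym (inner-sum k c))
... | inj₁ c∈G = c ∷ X , low s , λ { (here refl) → c∈G ; (there x∈X) → X⊆G x∈X }
... | inj₂ e∈G = X ∷ʳ _ , high s ,
                 λ x∈ → [ X⊆G , (λ { (here refl) → e∈G }) ]′ (∈-++⁻ X x∈)

-- Symmetric gapsets

module _ {G f} (gapset : IsGapset G) (frob : Frobenius G f) where
  open IsGapset gapset

  complement : ∀ {x y} → 0 < x → 0 < y → x + y ≡ f → x ∈ G ⊎ y ∈ G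
  complement 0<x 0<y eq = gap 0<x 0<y (subst (_∈ G) (sym eq) (last-∈ G frob))

  -- If both x and y = f − x were gaps, then G and the mirror image of G ∖ {y},
  -- which have 2g − 1 = f elements in total, would cover {0, …, f}.
  symmetric⇒disjoint : 2 * length G ≡ suc f → ∀ {x y} → x ∈ G → y ∈ G → x + y ≢ f
  symmetric⇒disjoint 2g≡1+f {x} {y} x∈G y∈G x+y≡f = contradiction f+1≤f 1+n≰n
    where
    cover : List ℕ
    cover = G ++ map (f ∸_) (G ─ y∈G)

    mirrored : ∀ z → z ≤ f → z ∉ G → f ∸ z ∈ G
    -- `complement` takes positive summands; the mirror image of 0 is `f` itself.
    mirrored zero    _    _   = last-∈ G frob
    mirrored (suc z) z<f  z∉G with m≤n⇒m<n∨m≡n z<f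
    ... | inj₂ refl = contradiction (last-∈ G frob) z∉G
    ... | inj₁ z<f′ with complement z<s (m<n⇒0<n∸m z<f′) (m+[n∸m]≡n z<f)
    ...   | inj₁ z∈G = contradiction z∈G z∉G
    ...   | inj₂ f∸z∈G = f∸z∈G

    covered : upTo (suc f) ⊆ cover
    covered {z} z∈ with _∈?_ _≟_ z G
    ... | yes z∈G = ∈-++⁺ˡ z∈G
    ... | no z∉G = ∈-++⁺ʳ G (subst (_∈ map (f ∸_) (G ─ y∈G)) (m∸[m∸n]≡n z≤f)
                     (∈-map⁺ (f ∸_) (∈-─⁺ y∈G (mirrored z z≤f z∉G) f∸z≢y)))
      where
      z≤f : z ≤ f
      z≤f = s≤s⁻¹ (∈-upTo⁻ z∈)
      -- Removing `y` from the mirrored set only loses its image `x`, which lies in `G`.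
      f∸z≢y : f ∸ z ≢ y
      f∸z≢y refl = z∉G (subst (_∈ G) (+-cancelʳ-≡ (f ∸ z) x z
                     (trans x+y≡f (sym (m+[n∸m]≡n z≤f)))) x∈G)

    length-cover : suc (length cover) ≡ suc f
    length-cover = begin
      suc (length cover)                                  ≡⟨ cong suc (length-++ G) ⟩
      suc (length G + length (map (f ∸_) (G ─ y∈G)))      ≡⟨ cong (λ l → suc (length G + l)) (length-map _ (G ─ y∈G)) ⟩
      suc (length G + length (G ─ y∈G))                   ≡⟨ +-suc _ _ ⟨
      length G + suc (length (G ─ y∈G))                   ≡⟨ cong (length G +_) (length-removeAt′ G (index y∈G)) ⟨
      length G + length G                                 ≡⟨ cong (length G +_) (+-identityʳ _) ⟨
      2 * length G                                        ≡⟨ 2g≡1+f ⟩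
      suc f                                               ∎
      where open ≡-Reasoning

    f+1≤f : suc f ≤ f
    f+1≤f = begin
      suc f                  ≡⟨ length-upTo (suc f) ⟨
      length (upTo (suc f))  ≤⟨ Unique-⊆⇒length≤ (Unique.upTo⁺ (suc f)) covered ⟩
      length cover           ≡⟨ suc-injective length-cover ⟩
      f                      ∎
      where open ≤-Reasoning

  -- The maximal difference of a symmetric gapset

  module _ (2g≡1+f : 2 * length G ≡ suc f) {κ} (sparse : PureSparse κ G) where
    open PureSparse sparse

    private
      G↗ : AllPairs _<_ G
      G↗ = Linked⇒AllPairs <-trans increasing

    -- Passing `t` instead of subtracting `j` from `κ` keeps the mirrored sums free of truncation.
    -- With `s = f − (a + κ)`, the run from `s + 1` to `s + κ − 1` lies in `G` and `s` does not;
    -- splitting `s + j` then leaves only `j`.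
    below-κ : ∀ {j t} → 0 < j → 0 < t → j + t ≡ κ → j ∈ G
    below-κ {j} {t} 0<j 0<t refl
      with a , a∈G , b∈G , free ← ∈-differences⁻ G↗ attained
      with s , f≡ ← m≤n⇒∃[o]m+o≡n (last-maximum G↗ frob b∈G)
      -- `a + t` lies strictly inside the difference from `a` to `a + κ`, and `s + j` is its mirror
      -- image.
      with complement {s + j} {a + t} (m≤n⇒m≤o+n s 0<j) (m≤n⇒m≤o+n a 0<t)
                      (trans (rearrange s j a t) f≡)
      where
      rearrange : ∀ s j a t → (s + j) + (a + t) ≡ (a + (j + t)) + s
      rearrange = solve-∀
    ... | inj₂ a+t∈G = contradiction a+t∈G
                         (free (m<m+n a 0<t) (+-monoʳ-< a (m<n+m t 0<j)))
    below-κ {j} 0<j 0<t refl | inj₁ s+j∈G with s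
    -- Here the difference ends at `f`, and `s + j` is already `j`.
    ... | zero = s+j∈G
    ... | suc s′ with gap z<s 0<j s+j∈G
    ...   | inj₂ j∈G = j∈G
    ...   | inj₁ s∈G = contradiction f≡ (symmetric⇒disjoint 2g≡1+f b∈G s∈G)

    -- The predecessor `p` of `f` cannot be closer than `κ`: by `below-κ` the distance `f − p` would
    -- then be in `G` along with `p`, against symmetry.
    f∸κ∈G : ∃[ p ] (p ∈ G × p + κ ≡ f)
    f∸κ∈G with p , p∈G , p<f , f≤p+κ ← last-predecessor G↗ bounded attained frob
      with m≤n⇒m<n∨m≡n f≤p+κ
    ... | inj₂ f≡p+κ = p , p∈G , sym f≡p+κ
    ... | inj₁ f<p+κ = contradiction (m+[n∸m]≡n (<⇒≤ p<f)) (symmetric⇒disjoint 2g≡1+f p∈G j∈G)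
      where
      j<κ : f ∸ p < κ
      j<κ = +-cancelˡ-< p _ _ (subst (_< p + κ) (sym (m+[n∸m]≡n (<⇒≤ p<f))) f<p+κ)
      j∈G : f ∸ p ∈ G
      j∈G = below-κ (m<n⇒0<n∸m p<f) (m<n⇒0<n∸m j<κ) (m+[n∸m]≡n (<⇒≤ j<κ))

-- The symmetric gapsets for n = k + 1

module _ (k : ℕ) where

  private
    -- For `n = k + 1`, `m` is `2n`, `f` is `2(3n + 1) − 1`, and `[c, c + 2k)` is the interval from
    -- `m + 2` to `2m − 1`.
    m c f : ℕ
    m = suc (suc (k + k))
    c = suc (suc m)
    f = suc (m + m + m)

  tail : List ℕ
  tail = suc (m + m) ∷ f ∷ []

  assemble : List ℕ → List ℕ
  assemble X = applyUpTo suc (suc (k + k)) ++ suc m ∷ (X ++ tail)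

  assemble-injective : ∀ {X Y} → assemble X ≡ assemble Y → X ≡ Y
  assemble-injective eq =
    ++-cancelʳ tail _ _ (∷-injectiveʳ (++-cancelˡ (applyUpTo suc (suc (k + k))) _ _ eq))

  <m⇒∈assemble : ∀ {x X} → 0 < x → x < m → x ∈ assemble X
  <m⇒∈assemble {suc x} _ (s≤s x<) = ∈-++⁺ˡ (∈-applyUpTo⁺ suc x<)

  ∈-assemble-++ : ∀ {x X} → x ∈ X ++ tail → x ∈ assemble X
  ∈-assemble-++ x∈ = ∈-++⁺ʳ (applyUpTo suc (suc (k + k))) (there x∈)

  data ∈-assemble-Cases (X : List ℕ) (x : ℕ) : Set where
    small  : x < m → ∈-assemble-Cases X x
    1+m    : x ≡ suc m → ∈-assemble-Cases X x
    chosen : x ∈ X → ∈-assemble-Cases X x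
    1+2m   : x ≡ suc (m + m) → ∈-assemble-Cases X x
    1+3m   : x ≡ f → ∈-assemble-Cases X x

  ∈-assemble⁻ : ∀ {x} X → x ∈ assemble X → ∈-assemble-Cases X x
  ∈-assemble⁻ X x∈ with ∈-++⁻ (applyUpTo suc (suc (k + k))) x∈
  ... | inj₁ x∈ˡ with i , i< , refl ← ∈-applyUpTo⁻ suc x∈ˡ = small (s<s i<)
  ... | inj₂ (here eq) = 1+m eq
  ... | inj₂ (there x∈ʳ) with ∈-++⁻ X x∈ʳ
  ...   | inj₁ x∈X                = chosen x∈X
  ...   | inj₂ (here eq)          = 1+2m eq
  ...   | inj₂ (there (here eq))  = 1+3m eq

  assemble-⊆ : ∀ {X G} → (∀ {x} → 0 < x → x < m → x ∈ G) → suc m ∈ G → X ⊆ G →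
               suc (m + m) ∈ G → f ∈ G → assemble X ⊆ G
  assemble-⊆ {X} below-m 1+m∈G X⊆G 1+2m∈G f∈G x∈
    with ∈-++⁻ (applyUpTo suc (suc (k + k))) x∈
  ... | inj₁ x∈ˡ with i , i< , refl ← ∈-applyUpTo⁻ suc x∈ˡ = below-m z<s (s<s i<)
  ... | inj₂ (here refl) = 1+m∈G
  ... | inj₂ (there x∈ʳ) with ∈-++⁻ X x∈ʳ
  ...   | inj₁ x∈X                 = X⊆G x∈X
  ...   | inj₂ (here refl)         = 1+2m∈G
  ...   | inj₂ (there (here refl)) = f∈G

  c+2k≡2m : c + (k + k) ≡ m + m
  c+2k≡2m = lemma k
    where
    lemma : ∀ k → suc (suc (suc (suc (k + k)))) + (k + k) ≡ suc (suc (k + k)) + suc (suc (k + k))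
    lemma = solve-∀

  -- Makes the pairs of a `Selection k c` the pairs `{x, f − x}`: the interval is centred at
  -- `f / 2`. The successor avoids subtracting 1.
  pair-sum : suc f ≡ c + (c + (k + k))
  pair-sum = trans (lemma m) (cong (c +_) (sym c+2k≡2m))
    where
    lemma : ∀ m → suc (suc (m + m + m)) ≡ suc (suc m) + (m + m)
    lemma = solve-∀

  -- Counts block by block: `m − 1` small elements, `m + 1`, the `k` chosen ones and the two in
  -- `tail`.
  genus-value : 3 * suc k + 1 ≡ suc (k + k) + suc (k + 2)
  genus-value = lemma k
    where
    lemma : ∀ k → 3 * suc k + 1 ≡ suc (k + k) + suc (k + 2)
    lemma = solve-∀

  2genus≡1+f : 2 * (3 * suc k + 1) ≡ suc f
  2genus≡1+f = lemma k
    where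
    lemma : ∀ k → 2 * (3 * suc k + 1) ≡
                  suc (suc (suc (suc (k + k)) + suc (suc (k + k)) + suc (suc (k + k))))
    lemma = solve-∀

  -- From selections to symmetric gapsets

  module _ {X} (s : Selection k c X) where

    -- The elements `m + 1` and `2m + 1` cut the list into windows `[1, m + 1]`, `[m + 1, 2m + 1]`
    -- and `[2m + 1, 3m + 1]` of width `m` with shared ends, so every difference lies inside one
    -- window.
    assemble-Linked : Linked (Step m) (assemble X)
    assemble-Linked = Linked-glue A
      (within⇒Linked-Step 1 (AllPairs⇒Linked A∷ʳ↗) A∷ʳ-within)
      (Linked-glue (suc m ∷ X)
        (within⇒Linked-Step (suc m) (AllPairs⇒Linked mid↗) mid-within)
        ((m<m+n (suc (m + m)) z<s , ≤-reflexive (m+n∸m≡n (suc (m + m)) m)) ∷ [-]))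
      where
      A = applyUpTo suc (suc (k + k))
      A-within : All (λ x → 1 ≤ x × x < m) A
      A-within = All.applyUpTo⁺₁ suc _ λ i< → s≤s z≤n , s<s i<
      A∷ʳ↗ : AllPairs _<_ (A ∷ʳ suc m)
      A∷ʳ↗ = AllPairs.++⁺ (AllPairs.applyUpTo⁺₁ suc _ λ i<j _ → s<s i<j) ([] ∷ [])
               (All.map (λ (_ , u) → m<n⇒m<1+n u ∷ []) A-within)
      A∷ʳ-within : All (λ x → 1 ≤ x × x ≤ 1 + m) (A ∷ʳ suc m)
      A∷ʳ-within = All.∷ʳ⁺ (All.map (λ (l , u) → l , m≤n⇒m≤1+n (<⇒≤ u)) A-within)
                           (s≤s z≤n , ≤-refl)
      X-within : All (λ x → suc m < x × x < suc (m + m)) X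
      X-within = All.map (λ (l , u) → l , m<n⇒m<1+n (<-≤-trans u (≤-reflexive c+2k≡2m)))
                         (Selection-bounds s)
      m<2m : suc m < suc (m + m)
      m<2m = s<s (m<m+n m z<s)
      mid↗ : AllPairs _<_ (suc m ∷ X ∷ʳ suc (m + m))
      mid↗ = All.∷ʳ⁺ (All.map proj₁ X-within) m<2m ∷
             AllPairs.++⁺ (Selection-increasing s) ([] ∷ [])
                          (All.map (λ (_ , u) → u ∷ []) X-within)
      mid-within : All (λ x → suc m ≤ x × x ≤ suc m + m) (suc m ∷ X ∷ʳ suc (m + m))
      mid-within = (≤-refl , <⇒≤ m<2m) ∷
                   All.∷ʳ⁺ (All.map (λ (l , u) → <⇒≤ l , <⇒≤ u) X-within) (<⇒≤ m<2m , ≤-refl)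

    assemble-positive : All (0 <_) (assemble X)
    assemble-positive = All.++⁺ (All.applyUpTo⁺₂ suc (suc (k + k)) λ _ → z<s)
      (z<s ∷ All.++⁺ (All.map (λ (l , _) → <-≤-trans z<s l) (Selection-bounds s))
                     (z<s ∷ z<s ∷ []))

    -- Positive numbers below `m` are members, so let both summands be at least `m`. Only the totals
    -- `2m + 1` and `3m + 1` reach `2m`. A summand `m` leaves `m + 1` or `2m + 1`, a summand `m + 1`
    -- is a member, and two summands from `m + 2` on with total `f` form a pair of the selection.
    assemble-gap : ∀ {x y} → 0 < x → 0 < y → x + y ∈ assemble X →
                   x ∈ assemble X ⊎ y ∈ assemble X
    assemble-gap {x} {y} 0<x 0<y x+y∈ with m ≤? x | m ≤? y
    ... | no m≰x | _ = inj₁ (<m⇒∈assemble 0<x (≰⇒> m≰x))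
    ... | yes _ | no m≰y = inj₂ (<m⇒∈assemble 0<y (≰⇒> m≰y))
    ... | yes m≤x | yes m≤y = large (∈-assemble⁻ X x+y∈)
      where
      2m≤x+y : m + m ≤ x + y
      2m≤x+y = +-mono-≤ m≤x m≤y
      1+m∈ : suc m ∈ assemble X
      1+m∈ = ∈-++⁺ʳ (applyUpTo suc (suc (k + k))) (here refl)
      1+2m∈ : suc (m + m) ∈ assemble X
      1+2m∈ = ∈-assemble-++ (∈-++⁺ʳ X (here refl))

      large : ∈-assemble-Cases X (x + y) → x ∈ assemble X ⊎ y ∈ assemble X
      large (small x+y<m) = contradiction (≤-trans (m≤m+n m m) 2m≤x+y) (<⇒≱ x+y<m)
      large (1+m x+y≡) =
        -- `m + 1 < 2m` because `m` is at least 2.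
        contradiction (≤-trans 2m≤x+y (≤-reflexive x+y≡)) (<⇒≱ (+-monoˡ-< m (s<s (z<s {k + k}))))
      large (chosen x+y∈X) = contradiction 2m≤x+y
        (<⇒≱ (<-≤-trans (proj₂ (All.lookup (Selection-bounds s) x+y∈X)) (≤-reflexive c+2k≡2m)))
      large (1+2m x+y≡) with m≤n⇒m<n∨m≡n m≤x | m≤n⇒m<n∨m≡n m≤y
      ... | inj₂ refl | _ =
        inj₂ (subst (_∈ assemble X) (sym (+-cancelˡ-≡ m y (suc m) (trans x+y≡ (sym (+-suc m m))))) 1+m∈)
      ... | inj₁ _ | inj₂ refl =
        inj₁ (subst (_∈ assemble X) (sym (+-cancelʳ-≡ m x (suc m) x+y≡)) 1+m∈)
      ... | inj₁ m<x | inj₁ m<y =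
        contradiction (≤-trans (+-mono-≤ m<x m<y) (≤-reflexive x+y≡))
                      (<⇒≱ (s<s (+-monoʳ-< m ≤-refl)))
      large (1+3m x+y≡) with m≤n⇒m<n∨m≡n m≤x | m≤n⇒m<n∨m≡n m≤y
      ... | inj₂ refl | _ =
        inj₂ (subst (_∈ assemble X) (sym (+-cancelˡ-≡ m y (suc (m + m))
                      (trans x+y≡ (trans (cong suc (+-assoc m m m)) (sym (+-suc m (m + m))))))) 1+2m∈)
      ... | inj₁ _ | inj₂ refl =
        inj₁ (subst (_∈ assemble X) (sym (+-cancelʳ-≡ m x (suc (m + m)) x+y≡)) 1+2m∈)
      ... | inj₁ m<x | inj₁ m<y with m≤n⇒m<n∨m≡n m<x | m≤n⇒m<n∨m≡n m<y
      ...   | inj₂ refl | _ = inj₁ 1+m∈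
      ...   | inj₁ _ | inj₂ refl = inj₂ 1+m∈
      ...   | inj₁ c≤x | inj₁ c≤y =
        [ inj₁ ∘ ∈-assemble-++ ∘ ∈-++⁺ˡ , inj₂ ∘ ∈-assemble-++ ∘ ∈-++⁺ˡ ]′
          (Selection-meets-pairs s c≤x c≤y (trans (cong suc x+y≡) pair-sum))

    assemble-genus : genus (assemble X) ≡ 3 * suc k + 1
    assemble-genus = begin
      length (assemble X)
        ≡⟨ length-++ (applyUpTo suc (suc (k + k))) ⟩
      length (applyUpTo suc (suc (k + k))) + suc (length (X ++ tail))
        ≡⟨ cong₂ (λ a b → a + suc b) (length-applyUpTo suc (suc (k + k))) (length-++ X) ⟩
      suc (k + k) + suc (length X + 2)
        ≡⟨ cong (λ l → suc (k + k) + suc (l + 2)) (Selection-length s) ⟩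
      suc (k + k) + suc (k + 2)
        ≡⟨ genus-value ⟨
      3 * suc k + 1
        ∎
      where open ≡-Reasoning

    assemble-𝒢 : 𝒢 m (3 * suc k + 1) (assemble X)
    assemble-𝒢 = record
      { isGapset   = record
        { increasing = Linked.map proj₁ assemble-Linked
        ; positive   = assemble-positive
        ; gap        = assemble-gap
        }
      ; pureSparse = record
        { bounded  = Linked-Step⇒bounded assemble-Linked
        -- The difference `m` occurs at the very end, from `2m + 1` to `f`.
        ; attained = ∈-differences-++⁺ʳ (applyUpTo suc (suc (k + k)))
                       (∈-differences-++⁺ʳ (suc m ∷ X) (here (sym (m+n∸m≡n (suc (m + m)) m))))
        }
      ; hasGenus   = assemble-genus
      }

    assemble-Symmetric : Symmetric (assemble X)
    assemble-Symmetric = begin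
      last (assemble X)                       ≡⟨ last-++ (applyUpTo suc (suc (k + k))) ⟩
      last (suc m ∷ X ++ tail)                ≡⟨ last-++ (suc m ∷ X) ⟩
      just f                                  ≡⟨ cong (λ l → just (l ∸ 1)) 2genus≡1+f ⟨
      just (2 * (3 * suc k + 1) ∸ 1)          ≡⟨ cong (λ g → just (2 * g ∸ 1)) assemble-genus ⟨
      just (2 * genus (assemble X) ∸ 1)       ∎
      where open ≡-Reasoning

  -- From symmetric gapsets to selections

  symmetric⇒assemble : ∀ {G} → 𝒢 m (3 * suc k + 1) G → Symmetric G →
                       ∃[ X ] (Selection k c X × G ≡ assemble X)
  symmetric⇒assemble {G} G∈𝒢 symm = case choice of λ (X , s , X⊆G) → X , s , sym
    -- `assemble X` and `G` are increasing of the same length, so the inclusion is an equality; this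
    -- excludes from `G` the unchosen member of each pair.
    (increasing-⊆⇒≡ (Linked⇒AllPairs <-trans (Linked.map proj₁ (assemble-Linked s)))
                    (Linked⇒AllPairs <-trans increasing)
                    (trans (assemble-genus s) (sym hasGenus))
                    (assemble-⊆ below-m∈G 1+m∈G X⊆G 1+2m∈G (last-∈ G frob)))
    where
    open 𝒢 G∈𝒢
    open IsGapset isGapset

    2g≡1+f : 2 * length G ≡ suc f
    2g≡1+f = trans (cong (2 *_) hasGenus) 2genus≡1+f
    frob : Frobenius G f
    frob = trans symm (cong (λ l → just (l ∸ 1)) 2g≡1+f)

    below-m∈G : ∀ {x} → 0 < x → x < m → x ∈ G
    below-m∈G 0<x x<m = below-κ isGapset frob 2g≡1+f pureSparse
                          0<x (m<n⇒0<n∸m x<m) (m+[n∸m]≡n (<⇒≤ x<m))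

    1+2m∈G : suc (m + m) ∈ G
    1+2m∈G with p , p∈G , p+m≡f ← f∸κ∈G isGapset frob 2g≡1+f pureSparse =
      subst (_∈ G) (+-cancelʳ-≡ m p (suc (m + m)) p+m≡f) p∈G

    m∉G : m ∉ G
    m∉G m∈G = symmetric⇒disjoint isGapset frob 2g≡1+f 1+2m∈G m∈G refl

    -- A with-abstraction here would normalise the ring solver's proof terms.
    1+m∈G : suc m ∈ G
    1+m∈G = [ id , (λ m∈G → contradiction m∈G m∉G) ]′ (gap {suc m} {m} z<s z<s 1+2m∈G)

    choice : ∃[ X ] (Selection k c X × X ⊆ G)
    -- Each pair sums to `f`, an element of `G`, so the gapset property puts one of its members into
    -- `G`.
    choice = Selection-within k c λ c≤x c≤y eq →
      complement isGapset frob (<-≤-trans z<s c≤x) (<-≤-trans z<s c≤y)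
                 (suc-injective (trans eq (sym pair-sum)))

  -- The count

  symmetric-cardinality :
    HasCardinality (λ G → 𝒢 m (3 * suc k + 1) G × Symmetric G) (2 ^ k)
  symmetric-cardinality =
    map assemble (selections k c) ,
    Unique.map⁺ assemble-injective (selections-Unique k c) ,
    trans (length-map assemble (selections k c)) (length-selections k c) ,
    λ G → mk⇔
      (λ G∈ → case ∈-map⁻ assemble G∈ of λ where
        (X , X∈ , refl) → let s = ∈-selections⁻ k c X∈ in assemble-𝒢 s , assemble-Symmetric s)
      (λ (G∈𝒢 , symm) → case symmetric⇒assemble G∈𝒢 symm of λ where
        (X , s , refl) → ∈-map⁺ assemble (∈-selections⁺ s))

mainTheorem4 : ∀ (n : ℕ) → 1 ≤ n →
    HasCardinality (λ G → 𝒢 (2 * n) (3 * n + 1) G × Symmetric G) (2 ^ (n ∸ 1))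
mainTheorem4 (suc k) _ =
  -- `m` equals `2 * n` only propositionally, hence the transport.
  subst (λ κ → HasCardinality (λ G → 𝒢 κ (3 * suc k + 1) G × Symmetric G) (2 ^ k))
        (double k) (symmetric-cardinality k)
  where
  double : ∀ k → suc (suc (k + k)) ≡ 2 * suc k
  double = solve-∀
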